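{- A homogeneous PDM$(3,n)$ exists for every positive integer $n\equiv 1\pmod{12}$.
   Context: Let $m$ be a positive integer and $n$ a positive odd integer. An $m\times n$ matrix $D=(d_{ij})$ with entries in $\{0,1,\dots,n-1\}$ is a perfect difference matrix PDM$(m,n)$ if for all $1\leq i_1<i_2\leq m$ the multiset of integer differences (no reduction modulo $n$) $\{d_{i_1,j}-d_{i_2,j}: 1\leq j\leq n\}$ equals $\{ -(n-1)/2,\dots,(n-1)/2\}$. It is homogeneous if each row contains every element of $\{0,1,\dots,n-1\}$. -}

module Defs where

open import Data.Nat using (ℕ; zero; suc; _<_; _∸_; _/_)
open import Data.Integer using (ℤ; +_; -_; _-_)
open import Data.Fin using (Fin; toℕ)
open import Data.List using (List; map; upTo; allFin)
open import Data.List.Relation.Binary.Permutation.Propositional using (_↭_)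
open import Data.Product using (∃)
open import Relation.Binary.PropositionalEquality using (_≡_)

Matrix : ℕ → ℕ → Set
Matrix m n = Fin m → Fin n → Fin n

entry : ∀ {m n} → Matrix m n → Fin m → Fin n → ℤ
entry D i j = + toℕ (D i j)

diffs : ∀ {m n} → Matrix m n → Fin m → Fin m → List ℤ
diffs {n = n} D i₁ i₂ = map (λ j → entry D i₁ j - entry D i₂ j) (allFin n)

-- the list -(n-1)/2, …, (n-1)/2  (n odd); i.e. k - (n-1)/2 for k = 0..n-1
centredRange : ℕ → List ℤ
centredRange n = map (λ k → + k - + ((n ∸ 1) / 2)) (upTo n)

-- perfect difference matrix: for all i1 < i2 the multiset of differences
-- equals {-(n-1)/2,…,(n-1)/2} (multiset equality = permutation of lists)
IsPDM : ∀ {m n} → Matrix m n → Set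
IsPDM {m} {n} D = ∀ (i₁ i₂ : Fin m) → toℕ i₁ < toℕ i₂ → diffs D i₁ i₂ ↭ centredRange n

IsHomogeneous : ∀ {m n} → Matrix m n → Set
IsHomogeneous {m} {n} D = ∀ (i : Fin m) (x : Fin n) → ∃ λ j → D i j ≡ x

{-# OPTIONS --safe #-}
module Submission where

-- Write n = 12t + 1.  Suppose t four-element blocks of integers are given whose 6t positive
-- differences are exactly 1, …, 6t (a perfect difference family).  Permuting each block by the
-- twelve elements of the alternating group A₄, which is sharply 2-transitive, and adding a zero
-- column gives n columns of height 4 in which the difference of any two rows runs through
-- -6t, …, 6t.  Subtracting the last row from the first three (and translating) gives a
-- homogeneous PDM(3, n).
--
-- For large t the blocks are six families of the form (aᵢ s + bᵢ + i u), 0 ≤ i < 4,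
-- u < s + const, together with thirteen further blocks, all linear in s; here t = 6 s + const, one
-- such system for each residue of t modulo 6.  Their differences form arithmetic progressions of
-- steps 1, 2, 3.  A progression is the difference of two half-infinite ones, each a sum of
-- progressions {x, x + 6, x + 12, …}, so that the claim that they tile 1, …, 6t for every s
-- becomes an equality of two explicit multisets of linear forms in s.
--
-- There is no perfect difference family for t = 2, 3; there the Klein group suffices.

open import Defs
open import Data.Bool using (Bool; true; false; if_then_else_; T)
open import Data.Fin using (Fin; toℕ; fromℕ<; inject₁; _≟_)
open import Data.Fin.Patterns using (0F; 1F; 2F; 3F)
open import Data.Fin.Properties using (toℕ<n; toℕ-fromℕ<; toℕ-injective; toℕ-inject₁)
open import Data.Integer as ℤ using (ℤ; +_; -[1+_]; -_; 0ℤ)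
import Data.Integer.Properties as ℤ
open import Data.Integer.Tactic.RingSolver using (solve-∀)
open import Data.List using (List; []; _∷_; _++_; map; length; lookup; concatMap; cartesianProductWith; upTo; applyUpTo; allFin; tabulate)
open import Data.List.Properties using (length-map; length-upTo; length-++; length-applyUpTo; map-++; map-cong; map-applyUpTo; map-tabulate; tabulate-lookup)
open import Data.List.Membership.DecPropositional ℤ._≟_ using (_∈?_)
open import Data.List.Membership.Propositional using (_∈_; find)
open import Data.List.Membership.Propositional.Properties
open import Data.List.Relation.Binary.Permutation.Propositional as ↭ using (_↭_; prep)
open import Data.List.Relation.Binary.Permutation.Propositional.Properties using (shift; ∈-resp-↭; map⁺; ↭-length)
open import Data.List.Relation.Unary.All as All using (All)
open import Data.List.Relation.Unary.AllPairs using ([]; _∷_)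
open import Data.List.Relation.Unary.Any as Any using (Any; here; there; any?; index)
open import Data.List.Relation.Unary.Any.Properties using (lookup-index)
open import Data.List.Relation.Unary.Unique.Propositional using (Unique)
import Data.List.Relation.Unary.Unique.Propositional.Properties as Unique
open import Data.Maybe using (Maybe; just; nothing; is-just; to-witness-T)
open import Data.Nat using (ℕ; zero; suc; _+_; _*_; _∸_; _/_; _%_; _<_; _≤_; s≤s; s≤s⁻¹; z≤n; _<?_)
open import Data.Nat.DivMod using (m≡m%n+[m/n]*n; m*n/n≡m; m%n<n)
open import Data.Nat.ListAction using (sum)
open import Data.Nat.ListAction.Properties using (sum-++; sum-↭)
import Data.Nat.Properties as ℕ
import Data.Nat.Tactic.RingSolver as ℕSolver
open import Data.Product using (Σ; ∃; ∃₂; _×_; _,_; proj₁; proj₂)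
open import Data.Product.Properties using (≡-dec)
open import Data.Sum using (inj₁; inj₂)
open import Data.Vec as Vec using (Vec; []; _∷_)
open import Function using (_∘_; id)
open import Relation.Binary.PropositionalEquality
open import Relation.Nullary using (¬_; yes; no; contradiction)
open import Relation.Nullary.Decidable using (True; toWitness; ¬?; _→-dec_; _×-dec_)

unique-⊆⇒↭ : {A : Set} {xs ys : List A} → Unique ys → (∀ {y} → y ∈ ys → y ∈ xs) →
              length xs ≡ length ys → xs ↭ ys
unique-⊆⇒↭ {xs = []} [] _ _ = ↭.refl
unique-⊆⇒↭ {ys = y ∷ ys} (y∉ys ∷ uniq) ys⊆xs len with ∈-∃++ (ys⊆xs (here refl))
... | as , bs , refl = ↭.trans y-first (prep y (unique-⊆⇒↭ uniq ys⊆rest rest-len))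
  where
  y-first : as ++ y ∷ bs ↭ y ∷ as ++ bs
  y-first = shift y as bs
  rest-len : length (as ++ bs) ≡ length ys
  rest-len = ℕ.suc-injective (trans (sym (↭-length y-first)) len)
  ys⊆rest : ∀ {z} → z ∈ ys → z ∈ as ++ bs
  ys⊆rest z∈ys with ∈-resp-↭ y-first (ys⊆xs (there z∈ys))
  ... | here refl = contradiction refl (All.lookup y∉ys z∈ys)
  ... | there z∈rest = z∈rest

[i-j]+j≡i : ∀ i j → (i ℤ.- j) ℤ.+ j ≡ i
[i-j]+j≡i = solve-∀

j-i≡-[i-j] : ∀ i j → j ℤ.- i ≡ - (i ℤ.- j)
j-i≡-[i-j] = solve-∀

i-j-k≡i-[j+k] : ∀ i j k → i ℤ.- j ℤ.- k ≡ i ℤ.- (j ℤ.+ k)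
i-j-k≡i-[j+k] = solve-∀

centredRange-unique : ∀ n → Unique (centredRange n)
centredRange-unique n = Unique.map⁺ inj (Unique.upTo⁺ n)
  where
  mid = + ((n ∸ 1) / 2)
  inj : ∀ {k l} → + k ℤ.- mid ≡ + l ℤ.- mid → k ≡ l
  inj {k} {l} eq = ℤ.+-injective
    (trans (sym ([i-j]+j≡i (+ k) mid)) (trans (cong (ℤ._+ mid) eq) ([i-j]+j≡i (+ l) mid)))

length-centredRange : ∀ n → length (centredRange n) ≡ n
length-centredRange n = trans (length-map _ (upTo n)) (length-upTo n)

Column : Set
Column = Fin 4 → ℤ

gap : Fin 4 → Fin 4 → Column → ℤ
gap i k q = q i ℤ.- q k

Perfect : List Column → Set
Perfect cols = ∀ i k → toℕ i < toℕ k →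
  ∀ {v} → v ∈ centredRange (length cols) → v ∈ map (gap i k) cols

HomogeneousPDM₃ : ℕ → Set
HomogeneousPDM₃ n = Σ (Matrix 3 n) (λ D → IsPDM D × IsHomogeneous D)

module _ (cols : List Column) (perfect : Perfect cols) where
  private
    n : ℕ
    n = length cols
    mid : ℤ
    mid = + ((n ∸ 1) / 2)

    gaps↭ : ∀ i k → toℕ i < toℕ k → map (gap i k) cols ↭ centredRange n
    gaps↭ i k i<k = unique-⊆⇒↭ (centredRange-unique n) (perfect i k i<k)
      (trans (length-map _ cols) (sym (length-centredRange n)))

    row<3 : (i : Fin 3) → toℕ (inject₁ i) < 3
    row<3 0F = s≤s z≤n
    row<3 1F = s≤s (s≤s z≤n)
    row<3 2F = s≤s (s≤s (s≤s z≤n))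

    offset : (i : Fin 3) (j : Fin n) →
             ∃ λ k → k ∈ upTo n × gap (inject₁ i) 3F (lookup cols j) ≡ + k ℤ.- mid
    offset i j = ∈-map⁻ _ (∈-resp-↭ (gaps↭ (inject₁ i) 3F (row<3 i)) (∈-map⁺ _ (∈-lookup j)))

    D : Matrix 3 n
    D i j = fromℕ< (∈-upTo⁻ (proj₁ (proj₂ (offset i j))))

    entry-D : ∀ i j → entry D i j ≡ gap (inject₁ i) 3F (lookup cols j) ℤ.+ mid
    entry-D i j with offset i j
    ... | k , k∈ , eq = trans (cong +_ (toℕ-fromℕ< (∈-upTo⁻ k∈)))
      (trans (sym ([i-j]+j≡i (+ k) mid)) (cong (ℤ._+ mid) (sym eq)))

    entry-diff : ∀ i₁ i₂ j →
      entry D i₁ j ℤ.- entry D i₂ j ≡ gap (inject₁ i₁) (inject₁ i₂) (lookup cols j)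
    entry-diff i₁ i₂ j = trans (cong₂ ℤ._-_ (entry-D i₁ j) (entry-D i₂ j))
      (lemma (q (inject₁ i₁)) (q (inject₁ i₂)) (q 3F) mid)
      where
      q = lookup cols j
      lemma : ∀ a b c m → (a ℤ.- c ℤ.+ m) ℤ.- (b ℤ.- c ℤ.+ m) ≡ a ℤ.- b
      lemma = solve-∀

    diffs-D : ∀ i₁ i₂ → diffs D i₁ i₂ ≡ map (gap (inject₁ i₁) (inject₁ i₂)) cols
    diffs-D i₁ i₂ = begin
      diffs D i₁ i₂                              ≡⟨ map-cong (entry-diff i₁ i₂) (allFin n) ⟩
      map (g ∘ lookup cols) (allFin n)           ≡⟨ map-tabulate id (g ∘ lookup cols) ⟩
      tabulate (g ∘ lookup cols)                 ≡⟨ map-tabulate (lookup cols) g ⟨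
      map g (tabulate (lookup cols))             ≡⟨ cong (map g) (tabulate-lookup cols) ⟩
      map g cols                                 ∎
      where
      open ≡-Reasoning
      g = gap (inject₁ i₁) (inject₁ i₂)

    isPDM : IsPDM D
    isPDM i₁ i₂ i₁<i₂ = subst (_↭ centredRange n) (sym (diffs-D i₁ i₂))
      (gaps↭ (inject₁ i₁) (inject₁ i₂) (subst₂ _<_ (sym (toℕ-inject₁ i₁)) (sym (toℕ-inject₁ i₂)) i₁<i₂))

    isHomogeneous : IsHomogeneous D
    isHomogeneous i x = column-of (∈-map⁻ (gap (inject₁ i) 3F)
      (perfect (inject₁ i) 3F (row<3 i) (∈-map⁺ (λ k → + k ℤ.- mid) (∈-upTo⁺ (toℕ<n x)))))
      where
      open ≡-Reasoning
      column-of : (∃ λ q → q ∈ cols × + toℕ x ℤ.- mid ≡ gap (inject₁ i) 3F q) → ∃ λ j → D i j ≡ x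
      column-of (q , q∈cols , eq) = j , toℕ-injective (ℤ.+-injective (begin
        entry D i j                                       ≡⟨ entry-D i j ⟩
        gap (inject₁ i) 3F (lookup cols j) ℤ.+ mid        ≡⟨ cong (λ c → gap (inject₁ i) 3F c ℤ.+ mid) (lookup-index q∈cols) ⟨
        gap (inject₁ i) 3F q ℤ.+ mid                      ≡⟨ cong (ℤ._+ mid) eq ⟨
        + toℕ x ℤ.- mid ℤ.+ mid                           ≡⟨ [i-j]+j≡i (+ toℕ x) mid ⟩
        + toℕ x                                           ∎))
        where j = index q∈cols

  perfect⇒PDM : HomogeneousPDM₃ (length cols)
  perfect⇒PDM = D , isPDM , isHomogeneous

length-cartesianProductWith : {A B C : Set} (f : A → B → C) (xs : List A) (ys : List B) →
                              length (cartesianProductWith f xs ys) ≡ length xs * length ys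
length-cartesianProductWith f [] ys = refl
length-cartesianProductWith f (x ∷ xs) ys = trans (length-++ (map (f x) ys))
  (cong₂ _+_ (length-map (f x) ys) (length-cartesianProductWith f xs ys))

Perm₄ : Set
Perm₄ = Vec (Fin 4) 4

orbits : List Perm₄ → List Column → List Column
orbits G blocks = (λ _ → 0ℤ) ∷ cartesianProductWith (λ p σ → p ∘ Vec.lookup σ) blocks G

klein alternating : List Perm₄
klein =
  (0F ∷ 1F ∷ 2F ∷ 3F ∷ []) ∷ (1F ∷ 0F ∷ 3F ∷ 2F ∷ []) ∷
  (2F ∷ 3F ∷ 0F ∷ 1F ∷ []) ∷ (3F ∷ 2F ∷ 1F ∷ 0F ∷ []) ∷ []
alternating = klein ++
  (0F ∷ 2F ∷ 3F ∷ 1F ∷ []) ∷ (1F ∷ 3F ∷ 2F ∷ 0F ∷ []) ∷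
  (2F ∷ 0F ∷ 1F ∷ 3F ∷ []) ∷ (3F ∷ 1F ∷ 0F ∷ 2F ∷ []) ∷
  (0F ∷ 3F ∷ 1F ∷ 2F ∷ []) ∷ (1F ∷ 2F ∷ 0F ∷ 3F ∷ []) ∷
  (2F ∷ 1F ∷ 3F ∷ 0F ∷ []) ∷ (3F ∷ 0F ∷ 2F ∷ 1F ∷ []) ∷ []

alternating-2-transitive : ∀ i k a b → ¬ i ≡ k → ¬ a ≡ b →
  Any (λ σ → Vec.lookup σ i ≡ a × Vec.lookup σ k ≡ b) alternating
alternating-2-transitive i k a b =
  All.lookup (All.lookup (All.lookup (All.lookup checked
    (∈-allFin i)) (∈-allFin k)) (∈-allFin a)) (∈-allFin b)
  where
  checked : All (λ i → All (λ k → All (λ a → All (λ b → ¬ i ≡ k → ¬ a ≡ b →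
    Any (λ σ → Vec.lookup σ i ≡ a × Vec.lookup σ k ≡ b) alternating)
    (allFin 4)) (allFin 4)) (allFin 4)) (allFin 4)
  checked = toWitness {a? = All.all? (λ i → All.all? (λ k → All.all? (λ a → All.all? (λ b →
    ¬? (i ≟ k) →-dec (¬? (a ≟ b) →-dec
      any? (λ σ → (Vec.lookup σ i ≟ a) ×-dec (Vec.lookup σ k ≟ b)) alternating))
    (allFin 4)) (allFin 4)) (allFin 4)) (allFin 4)} _

-- Surjectivity suffices: there are as many block differences as values to be taken.
record PDF (t : ℕ) : Set where
  field
    blocks     : List Column
    #blocks    : length blocks ≡ t
    surjective : ∀ d → d < t * 6 → ∃ λ p → p ∈ blocks × ∃₂ λ a b → p a ℤ.- p b ≡ + suc d

centredRange-bound : ∀ t {v} → v ∈ centredRange (suc (t * 12)) → ℤ.∣ v ∣ ≤ t * 6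
centredRange-bound t {v} v∈ with ∈-map⁻ _ v∈
... | k , k∈ , refl = subst (λ h → ℤ.∣ + k ℤ.- + h ∣ ≤ t * 6) (sym half) bound
  where
  double : t * 12 ≡ t * 6 * 2
  double = sym (ℕ.*-assoc t 6 2)
  half : t * 12 / 2 ≡ t * 6
  half = trans (cong (_/ 2) double) (m*n/n≡m (t * 6) 2)
  k≤ : k ≤ t * 6 + t * 6
  k≤ = subst (k ≤_) (lemma t) (s≤s⁻¹ (∈-upTo⁻ k∈))
    where
    lemma : ∀ t → t * 12 ≡ t * 6 + t * 6
    lemma = ℕSolver.solve-∀
  bound : ℤ.∣ + k ℤ.- + (t * 6) ∣ ≤ t * 6
  bound rewrite ℤ.m-n≡m⊖n k (t * 6) with ℕ.≤-total (t * 6) k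
  ... | inj₁ h≤k rewrite ℤ.⊖-≥ h≤k = ℕ.m≤n+o⇒m∸n≤o k (t * 6) k≤
  ... | inj₂ k≤h rewrite ℤ.∣⊖∣-≤ k≤h = ℕ.m∸n≤m (t * 6) k

module _ {t : ℕ} (pdf : PDF t) where
  open PDF pdf
  private
    cols : List Column
    cols = orbits alternating blocks

    length-cols : length cols ≡ suc (t * 12)
    length-cols = cong suc
      (trans (length-cartesianProductWith _ blocks alternating) (cong (_* 12) #blocks))

    hit : ∀ {p a b v} i k → toℕ i < toℕ k → p ∈ blocks → ¬ a ≡ b → p a ℤ.- p b ≡ v →
          v ∈ map (gap i k) cols
    hit {p} {a} {b} i k i<k p∈ a≢b eq =
      via (find (alternating-2-transitive i k a b (λ i≡k → ℕ.<⇒≢ i<k (cong toℕ i≡k)) a≢b))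
      where
      via : (∃ λ σ → σ ∈ alternating × Vec.lookup σ i ≡ a × Vec.lookup σ k ≡ b) →
            _ ∈ map (gap i k) cols
      via (σ , σ∈ , refl , refl) = subst (_∈ map (gap i k) cols) eq
        (∈-map⁺ (gap i k) {xs = cols} (there (∈-cartesianProductWith⁺ (λ p σ → p ∘ Vec.lookup σ) p∈ σ∈)))

    distinct : ∀ (p : Column) {a b d} → p a ℤ.- p b ≡ + suc d → ¬ a ≡ b
    distinct p {a} eq refl with trans (sym eq) (ℤ.+-inverseʳ (p a))
    ... | ()

    perfect : Perfect cols
    perfect i k i<k {v} v∈ =
      cover v (centredRange-bound t (subst (λ n → v ∈ centredRange n) length-cols v∈))
      where
      cover : (v : ℤ) → ℤ.∣ v ∣ ≤ t * 6 → v ∈ map (gap i k) (orbits alternating blocks)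
      cover (+ zero) _ = here refl
      cover (+ suc d) d< with surjective d d<
      ... | p , p∈ , a , b , eq = hit i k i<k p∈ (distinct p eq) eq
      cover -[1+ d ] d< with surjective d d<
      ... | p , p∈ , a , b , eq = hit i k i<k p∈ (distinct p eq ∘ sym)
        (trans (j-i≡-[i-j] (p a) (p b)) (cong -_ eq))

  PDF⇒PDM : HomogeneousPDM₃ (suc (t * 12))
  PDF⇒PDM = subst HomogeneousPDM₃ length-cols (perfect⇒PDM cols perfect)

∑ : ℕ → (ℕ → ℕ) → ℕ
∑ n f = sum (applyUpTo f n)

∑-cong : ∀ n {f g : ℕ → ℕ} → (∀ i → f i ≡ g i) → ∑ n f ≡ ∑ n g
∑-cong zero f≗g = refl
∑-cong (suc n) f≗g = cong₂ _+_ (f≗g 0) (∑-cong n (f≗g ∘ suc))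

∑-last : ∀ n f → f 0 + ∑ n (f ∘ suc) ≡ ∑ n f + f n
∑-last zero f = ℕ.+-comm (f 0) 0
∑-last (suc n) f = trans (cong (λ m → f 0 + m) (∑-last n (f ∘ suc))) (sym (ℕ.+-assoc (f 0) _ _))

sum-positive : ∀ {xs} → 0 < sum xs → ∃ λ x → x ∈ xs × 0 < x
sum-positive {suc x ∷ _} _ = suc x , here refl , s≤s z≤n
sum-positive {zero ∷ _} 0<sum with sum-positive 0<sum
... | x , x∈xs , 0<x = x , there x∈xs , 0<x

telescope↓ : ∀ n (F e : ℕ → ℕ) → (∀ u → F u ≡ e u + F (suc u)) → ∑ n e + F n ≡ F 0
telescope↓ zero F e step = refl
telescope↓ (suc n) F e step = trans (ℕ.+-assoc (e 0) _ _)
  (trans (cong (λ x → e 0 + x) (telescope↓ n (F ∘ suc) (e ∘ suc) (step ∘ suc))) (sym (step 0)))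

telescope↑ : ∀ n (F e : ℕ → ℕ) → (∀ u → F (suc u) ≡ e u + F u) → ∑ n e + F 0 ≡ F n
telescope↑ zero F e step = refl
telescope↑ (suc n) F e step = trans (rearrange (e 0) _ (F 0))
  (trans (cong (λ m → ∑ n (e ∘ suc) + m) (sym (step 0)))
    (telescope↑ n (F ∘ suc) (e ∘ suc) (step ∘ suc)))
  where
  rearrange : ∀ a b c → a + b + c ≡ b + (a + c)
  rearrange = ℕSolver.solve-∀

point ray : ℤ → ℕ
point (+ 0) = 1
point _ = 0
ray (+ 0) = 1
ray (+ suc (suc (suc (suc (suc (suc k)))))) = ray (+ k)
ray _ = 0

point-positive : ∀ {k} → 0 < point k → k ≡ 0ℤ
point-positive {+ 0} _ = refl

ray-step : ∀ k → ray k ≡ point k + ray (k ℤ.- + 6)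
ray-step (+ 0) = refl
ray-step (+ 1) = refl
ray-step (+ 2) = refl
ray-step (+ 3) = refl
ray-step (+ 4) = refl
ray-step (+ 5) = refl
ray-step (+ suc (suc (suc (suc (suc (suc k)))))) = refl
ray-step -[1+ k ] = refl

data Step : Set where
  one two three : Step

size teeth : Step → ℕ
size one = 1
size two = 2
size three = 3
teeth one = 6
teeth two = 3
teeth three = 2

size*teeth : ∀ d → size d * teeth d ≡ 6
size*teeth one = refl
size*teeth two = refl
size*teeth three = refl

-- ray and comb d are the indicators of the non-negative multiples of 6 and of size d.
comb : Step → ℤ → ℕ
comb d k = ∑ (teeth d) (λ i → ray (k ℤ.- + (size d * i)))

comb-step : ∀ d k → comb d k ≡ point k + comb d (k ℤ.- + size d)
comb-step d k = ℕ.+-cancelʳ-≡ (ray (k ℤ.- + 6)) _ _ (begin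
  comb d k + ray (k ℤ.- + 6)                            ≡⟨ cong (λ n → comb d k + ray (k ℤ.- + n)) (size*teeth d) ⟨
  ∑ (teeth d) f + f (teeth d)                           ≡⟨ ∑-last (teeth d) f ⟨
  f 0 + ∑ (teeth d) (f ∘ suc)                           ≡⟨ cong₂ _+_ f0 (∑-cong (teeth d) fsuc) ⟩
  ray k + comb d (k ℤ.- + size d)                       ≡⟨ cong (_+ comb d (k ℤ.- + size d)) (ray-step k) ⟩
  point k + ray (k ℤ.- + 6) + comb d (k ℤ.- + size d)   ≡⟨ rearrange (point k) _ _ ⟩
  point k + comb d (k ℤ.- + size d) + ray (k ℤ.- + 6)   ∎)
  where
  open ≡-Reasoning
  f : ℕ → ℕ
  f i = ray (k ℤ.- + (size d * i))
  f0 : f 0 ≡ ray k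
  f0 = cong ray (trans (cong (λ n → k ℤ.- + n) (ℕ.*-zeroʳ (size d))) (ℤ.+-identityʳ k))
  fsuc : ∀ i → f (suc i) ≡ ray (k ℤ.- + size d ℤ.- + (size d * i))
  fsuc i = cong ray (trans (cong (λ n → k ℤ.- + n) (ℕ.*-suc (size d) i)) (trans
    (cong (λ j → k ℤ.- j) (ℤ.pos-+ (size d) (size d * i)))
    (sym (i-j-k≡i-[j+k] k (+ size d) (+ (size d * i))))))
  rearrange : ∀ a b c → a + b + c ≡ a + c + b
  rearrange = ℕSolver.solve-∀

Form : Set
Form = ℤ × ℤ

⟦_⟧ : Form → ℕ → ℤ
⟦ α , β ⟧ s = α ℤ.* + s ℤ.+ β

_⊕_ _⊝_ : Form → Form → Form
(α , β) ⊕ (α′ , β′) = α ℤ.+ α′ , β ℤ.+ β′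
(α , β) ⊝ (α′ , β′) = α ℤ.- α′ , β ℤ.- β′

⟦⊕⟧ : ∀ f g s → ⟦ f ⊕ g ⟧ s ≡ ⟦ f ⟧ s ℤ.+ ⟦ g ⟧ s
⟦⊕⟧ (α , β) (α′ , β′) s = lemma α β α′ β′ (+ s)
  where
  lemma : ∀ a b c d s → (a ℤ.+ c) ℤ.* s ℤ.+ (b ℤ.+ d) ≡ (a ℤ.* s ℤ.+ b) ℤ.+ (c ℤ.* s ℤ.+ d)
  lemma = solve-∀

⟦⊝⟧ : ∀ f g s → ⟦ f ⊝ g ⟧ s ≡ ⟦ f ⟧ s ℤ.- ⟦ g ⟧ s
⟦⊝⟧ (α , β) (α′ , β′) s = lemma α β α′ β′ (+ s)
  where
  lemma : ∀ a b c d s → (a ℤ.- c) ℤ.* s ℤ.+ (b ℤ.- d) ≡ (a ℤ.* s ℤ.+ b) ℤ.- (c ℤ.* s ℤ.+ d)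
  lemma = solve-∀

Length : Set
Length = ℕ × ℕ

eval : Length → ℕ → ℕ
eval (n₁ , n₀) s = n₁ * s + n₀

scale : ℕ → Length → Form
scale c (n₁ , n₀) = + (c * n₁) , + (c * n₀)

⟦scale⟧ : ∀ c n s → ⟦ scale c n ⟧ s ≡ + (c * eval n s)
⟦scale⟧ c (n₁ , n₀) s = sym (begin
  + (c * (n₁ * s + n₀))              ≡⟨ cong +_ (lemma c n₁ n₀ s) ⟩
  + (c * n₁ * s + c * n₀)            ≡⟨ ℤ.pos-+ (c * n₁ * s) (c * n₀) ⟩
  + (c * n₁ * s) ℤ.+ + (c * n₀)      ≡⟨ cong (ℤ._+ + (c * n₀)) (ℤ.pos-* (c * n₁) s) ⟩
  + (c * n₁) ℤ.* + s ℤ.+ + (c * n₀)  ∎)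
  where
  open ≡-Reasoning
  lemma : ∀ c n₁ n₀ s → c * (n₁ * s + n₀) ≡ c * n₁ * s + c * n₀
  lemma = ℕSolver.solve-∀

data Direction : Set where
  up down : Direction

record Progression : Set where
  constructor progression
  field
    direction : Direction
    start     : Form
    step      : Step
    len       : Length

term : Progression → ℕ → ℕ → ℤ
term (progression up x d _) s u = ⟦ x ⟧ s ℤ.+ + (size d * u)
term (progression down x d _) s u = ⟦ x ⟧ s ℤ.- + (size d * u)

hits : ℤ → ℕ → Progression → ℕ
hits v s p = ∑ (eval (Progression.len p) s) (λ u → point (v ℤ.- term p s u))

toothForms : Step → Form → List Form
toothForms d x = applyUpTo (λ i → x ⊕ (0ℤ , + (size d * i))) (teeth d)

begins ends : Progression → List Form
begins (progression up x d n) = toothForms d x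
begins (progression down x d n) = toothForms d ((x ⊕ (0ℤ , + size d)) ⊝ scale (size d) n)
ends (progression up x d n) = toothForms d (x ⊕ scale (size d) n)
ends (progression down x d n) = toothForms d (x ⊕ (0ℤ , + size d))

weight : ℤ → ℕ → List Form → ℕ
weight v s fs = sum (map (λ f → ray (v ℤ.- ⟦ f ⟧ s)) fs)

⟦⊕const⟧ : ∀ x c s → ⟦ x ⊕ (0ℤ , c) ⟧ s ≡ ⟦ x ⟧ s ℤ.+ c
⟦⊕const⟧ x c s = trans (⟦⊕⟧ x (0ℤ , c) s) (cong (λ y → ⟦ x ⟧ s ℤ.+ y) (ℤ.+-identityˡ c))

weight-toothForms : ∀ v s d x → weight v s (toothForms d x) ≡ comb d (v ℤ.- ⟦ x ⟧ s)
weight-toothForms v s d x = trans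
  (cong sum (map-applyUpTo _ _ (teeth d)))
  (∑-cong (teeth d) λ i → cong ray (trans
    (cong (λ y → v ℤ.- y) (⟦⊕const⟧ x (+ (size d * i)) s))
    (sym (i-j-k≡i-[j+k] v (⟦ x ⟧ s) (+ (size d * i))))))

hits-balance : ∀ v s p → hits v s p + weight v s (ends p) ≡ weight v s (begins p)
hits-balance v s (progression up x d n) = begin
  ∑ N e + weight v s (ends p)
    ≡⟨ cong (λ m → ∑ N e + m) (trans (weight-toothForms v s d (x ⊕ scale (size d) n)) (cong (comb d) end≡)) ⟩
  ∑ N e + F N                  ≡⟨ telescope↓ N F e step ⟩
  F 0                          ≡⟨ cong (comb d) begin≡ ⟨
  comb d (v ℤ.- ⟦ x ⟧ s)       ≡⟨ weight-toothForms v s d x ⟨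
  weight v s (begins p)        ∎
  where
  open ≡-Reasoning
  p = progression up x d n
  N = eval n s
  e F : ℕ → ℕ
  e u = point (v ℤ.- (⟦ x ⟧ s ℤ.+ + (size d * u)))
  F u = comb d (v ℤ.- (⟦ x ⟧ s ℤ.+ + (size d * u)))
  end≡ : v ℤ.- ⟦ x ⊕ scale (size d) n ⟧ s ≡ v ℤ.- (⟦ x ⟧ s ℤ.+ + (size d * N))
  end≡ = cong (λ y → v ℤ.- y)
    (trans (⟦⊕⟧ x (scale (size d) n) s) (cong (λ y → ⟦ x ⟧ s ℤ.+ y) (⟦scale⟧ (size d) n s)))
  begin≡ : v ℤ.- ⟦ x ⟧ s ≡ v ℤ.- (⟦ x ⟧ s ℤ.+ + (size d * 0))
  begin≡ = cong (λ y → v ℤ.- y)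
    (sym (trans (cong (λ m → ⟦ x ⟧ s ℤ.+ + m) (ℕ.*-zeroʳ (size d))) (ℤ.+-identityʳ (⟦ x ⟧ s))))
  shift-term : ∀ u → v ℤ.- (⟦ x ⟧ s ℤ.+ + (size d * u)) ℤ.- + size d ≡
               v ℤ.- (⟦ x ⟧ s ℤ.+ + (size d * suc u))
  shift-term u = trans (lemma v (⟦ x ⟧ s) (+ size d) (+ (size d * u)))
    (cong (λ y → v ℤ.- (⟦ x ⟧ s ℤ.+ y))
      (trans (sym (ℤ.pos-+ (size d) (size d * u))) (cong +_ (sym (ℕ.*-suc (size d) u)))))
    where
    lemma : ∀ v x c y → v ℤ.- (x ℤ.+ y) ℤ.- c ≡ v ℤ.- (x ℤ.+ (c ℤ.+ y))
    lemma = solve-∀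
  step : ∀ u → F u ≡ e u + F (suc u)
  step u = trans (comb-step d _) (cong (λ y → e u + comb d y) (shift-term u))
hits-balance v s (progression down x d n) = begin
  ∑ N e + weight v s (ends p)
    ≡⟨ cong (λ m → ∑ N e + m) (trans (weight-toothForms v s d top) (cong (comb d) end≡)) ⟩
  ∑ N e + F 0                  ≡⟨ telescope↑ N F e step ⟩
  F N                          ≡⟨ cong (comb d) begin≡ ⟨
  comb d (v ℤ.- ⟦ top ⊝ scale (size d) n ⟧ s)
    ≡⟨ weight-toothForms v s d (top ⊝ scale (size d) n) ⟨
  weight v s (begins p)        ∎
  where
  open ≡-Reasoning
  p = progression down x d n
  N = eval n s
  e F : ℕ → ℕ
  e u = point (v ℤ.- (⟦ x ⟧ s ℤ.- + (size d * u)))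
  F u = comb d (v ℤ.- (⟦ x ⟧ s ℤ.- + (size d * u)) ℤ.- + size d)
  top : Form
  top = x ⊕ (0ℤ , + size d)
  end≡ : v ℤ.- ⟦ top ⟧ s ≡ v ℤ.- (⟦ x ⟧ s ℤ.- + (size d * 0)) ℤ.- + size d
  end≡ = trans (cong (λ y → v ℤ.- y) (⟦⊕const⟧ x (+ size d) s)) (trans (lemma v (⟦ x ⟧ s) (+ size d))
    (cong (λ m → v ℤ.- (⟦ x ⟧ s ℤ.- + m) ℤ.- + size d) (sym (ℕ.*-zeroʳ (size d)))))
    where
    lemma : ∀ v x c → v ℤ.- (x ℤ.+ c) ≡ v ℤ.- (x ℤ.- 0ℤ) ℤ.- c
    lemma = solve-∀
  begin≡ : v ℤ.- ⟦ top ⊝ scale (size d) n ⟧ s ≡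
           v ℤ.- (⟦ x ⟧ s ℤ.- + (size d * N)) ℤ.- + size d
  begin≡ = trans
    (cong (λ y → v ℤ.- y) (trans (⟦⊝⟧ top (scale (size d) n) s)
      (cong₂ ℤ._-_ (⟦⊕const⟧ x (+ size d) s) (⟦scale⟧ (size d) n s))))
    (lemma v (⟦ x ⟧ s) (+ size d) (+ (size d * N)))
    where
    lemma : ∀ v x c y → v ℤ.- (x ℤ.+ c ℤ.- y) ≡ v ℤ.- (x ℤ.- y) ℤ.- c
    lemma = solve-∀
  shift-term : ∀ u → v ℤ.- (⟦ x ⟧ s ℤ.- + (size d * suc u)) ℤ.- + size d ≡
               v ℤ.- (⟦ x ⟧ s ℤ.- + (size d * u))
  shift-term u = trans
    (cong (λ y → v ℤ.- (⟦ x ⟧ s ℤ.- y) ℤ.- + size d)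
      (trans (cong +_ (ℕ.*-suc (size d) u)) (ℤ.pos-+ (size d) (size d * u))))
    (lemma v (⟦ x ⟧ s) (+ size d) (+ (size d * u)))
    where
    lemma : ∀ v x c y → v ℤ.- (x ℤ.- (c ℤ.+ y)) ℤ.- c ≡ v ℤ.- (x ℤ.- y)
    lemma = solve-∀
  step : ∀ u → F (suc u) ≡ e u + F u
  step u = trans (cong (comb d) (shift-term u)) (comb-step d _)

extract : (f : Form) (gs : List Form) → Maybe (∃ λ hs → gs ↭ f ∷ hs)
extract f [] = nothing
extract f (g ∷ gs) with ≡-dec ℤ._≟_ ℤ._≟_ f g
... | yes refl = just (gs , ↭.refl)
... | no _ with extract f gs
...   | just (hs , gs↭) = just (g ∷ hs , ↭.trans (prep g gs↭) (↭.swap g f ↭.refl))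
...   | nothing = nothing

match : (fs gs : List Form) → Maybe (gs ↭ fs)
match [] [] = just ↭.refl
match [] (_ ∷ _) = nothing
match (f ∷ fs) gs with extract f gs
... | nothing = nothing
... | just (hs , gs↭) with match fs hs
...   | just hs↭ = just (↭.trans gs↭ (prep f hs↭))
...   | nothing = nothing

∈⇒≤sum : ∀ {x xs} → x ∈ xs → x ≤ sum xs
∈⇒≤sum (here refl) = ℕ.m≤m+n _ _
∈⇒≤sum (there x∈xs) = ℕ.≤-trans (∈⇒≤sum x∈xs) (ℕ.m≤n+m _ _)

totalHits : ℤ → ℕ → List Progression → ℕ
totalHits v s ps = sum (map (hits v s) ps)

weight-++ : ∀ v s fs gs → weight v s (fs ++ gs) ≡ weight v s fs + weight v s gs
weight-++ v s fs gs = trans (cong sum (map-++ _ fs gs)) (sum-++ (map _ fs) (map _ gs))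

totalHits-balance : ∀ v s ps →
  totalHits v s ps + weight v s (concatMap ends ps) ≡ weight v s (concatMap begins ps)
totalHits-balance v s [] = refl
totalHits-balance v s (p ∷ ps) = begin
  h + H + weight v s (ends p ++ concatMap ends ps)  ≡⟨ cong (λ m → h + H + m) (weight-++ v s (ends p) _) ⟩
  h + H + (e + E)                                   ≡⟨ interchange h H e E ⟩
  (h + e) + (H + E)                                 ≡⟨ cong₂ _+_ (hits-balance v s p) (totalHits-balance v s ps) ⟩
  weight v s (begins p) + weight v s (concatMap begins ps) ≡⟨ weight-++ v s (begins p) _ ⟨
  weight v s (concatMap begins (p ∷ ps))            ∎
  where
  open ≡-Reasoning
  h = hits v s p
  H = totalHits v s ps
  e = weight v s (ends p)
  E = weight v s (concatMap ends ps)
  interchange : ∀ a b c d → a + b + (c + d) ≡ a + c + (b + d)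
  interchange = ℕSolver.solve-∀

-- begins ps - ends ps = begins qs - ends qs, with the negative terms moved to the other side.
Balanced : List Progression → List Progression → Set
Balanced ps qs = concatMap begins ps ++ concatMap ends qs ↭ concatMap ends ps ++ concatMap begins qs

totalHits-≡ : ∀ v s ps qs → Balanced ps qs → totalHits v s ps ≡ totalHits v s qs
totalHits-≡ v s ps qs perm = ℕ.+-cancelʳ-≡ (E + E′) _ _ (begin
  H + (E + E′)       ≡⟨ ℕ.+-assoc H E E′ ⟨
  H + E + E′         ≡⟨ cong (_+ E′) (totalHits-balance v s ps) ⟩
  weight v s (concatMap begins ps) + E′ ≡⟨ weight-++ v s (concatMap begins ps) _ ⟨
  weight v s (concatMap begins ps ++ concatMap ends qs) ≡⟨ sum-↭ (map⁺ _ perm) ⟩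
  weight v s (concatMap ends ps ++ concatMap begins qs) ≡⟨ weight-++ v s (concatMap ends ps) _ ⟩
  E + weight v s (concatMap begins qs) ≡⟨ cong (λ m → E + m) (totalHits-balance v s qs) ⟨
  E + (H′ + E′)      ≡⟨ rearrange E H′ E′ ⟩
  H′ + (E + E′)      ∎)
  where
  open ≡-Reasoning
  H = totalHits v s ps
  H′ = totalHits v s qs
  E = weight v s (concatMap ends ps)
  E′ = weight v s (concatMap ends qs)
  rearrange : ∀ a b c → a + (b + c) ≡ b + (a + c)
  rearrange = ℕSolver.solve-∀

record Line : Set where
  constructor line
  field
    points : Vec (ℕ × ℕ) 4
    len    : Length

coordinate : Line → Fin 4 → Form
coordinate ℓ i with Vec.lookup (Line.points ℓ) i
... | α , β = + α , + β

block : Line → ℕ → ℕ → Column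
block ℓ s u i = ⟦ coordinate ℓ i ⟧ s ℤ.+ + (toℕ i * u)

lineBlocks : ℕ → Line → List Column
lineBlocks s ℓ = applyUpTo (block ℓ s) (eval (Line.len ℓ) s)

record Edge : Set where
  constructor edge
  field
    lower upper : Fin 4
    step        : Step
    gap≡step    : toℕ upper ≡ size step + toℕ lower

edges : List Edge
edges = edge 0F 1F one refl ∷ edge 1F 2F one refl ∷ edge 2F 3F one refl ∷
        edge 0F 2F two refl ∷ edge 1F 3F two refl ∷ edge 0F 3F three refl ∷ []

-- Chooses the orientation of each difference; soundness does not depend on the choice.
nonNegative : Form → Bool
nonNegative (-[1+ _ ] , _) = false
nonNegative (+ 0 , -[1+ _ ]) = false
nonNegative _ = true

edgeProgression : Line → Edge → Progression
edgeProgression ℓ (edge i k d _) = if nonNegative (coordinate ℓ k ⊝ coordinate ℓ i)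
  then progression up (coordinate ℓ k ⊝ coordinate ℓ i) d (Line.len ℓ)
  else progression down (coordinate ℓ i ⊝ coordinate ℓ k) d (Line.len ℓ)

edgeProgression-len : ∀ ℓ e → Progression.len (edgeProgression ℓ e) ≡ Line.len ℓ
edgeProgression-len ℓ (edge i k _ _) with nonNegative (coordinate ℓ k ⊝ coordinate ℓ i)
... | true = refl
... | false = refl

block-gap : ∀ ℓ s u (e : Edge) → let open Edge e in
  block ℓ s u upper ℤ.- block ℓ s u lower ≡
  ⟦ coordinate ℓ upper ⊝ coordinate ℓ lower ⟧ s ℤ.+ + (size step * u)
block-gap ℓ s u (edge i k d k≡d+i) = begin
  x ℤ.+ + (toℕ k * u) ℤ.- (y ℤ.+ b)
    ≡⟨ cong (λ m → x ℤ.+ + m ℤ.- (y ℤ.+ b)) (trans (cong (_* u) k≡d+i) (ℕ.*-distribʳ-+ u (size d) (toℕ i))) ⟩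
  x ℤ.+ + (size d * u + toℕ i * u) ℤ.- (y ℤ.+ b)
    ≡⟨ cong (λ m → x ℤ.+ m ℤ.- (y ℤ.+ b)) (ℤ.pos-+ (size d * u) (toℕ i * u)) ⟩
  x ℤ.+ (a ℤ.+ b) ℤ.- (y ℤ.+ b)       ≡⟨ lemma x y a b ⟩
  (x ℤ.- y) ℤ.+ a                     ≡⟨ cong (ℤ._+ a) (⟦⊝⟧ (coordinate ℓ k) (coordinate ℓ i) s) ⟨
  ⟦ coordinate ℓ k ⊝ coordinate ℓ i ⟧ s ℤ.+ a ∎
  where
  open ≡-Reasoning
  x = ⟦ coordinate ℓ k ⟧ s
  y = ⟦ coordinate ℓ i ⟧ s
  a = + (size d * u)
  b = + (toℕ i * u)
  lemma : ∀ x y a b → x ℤ.+ (a ℤ.+ b) ℤ.- (y ℤ.+ b) ≡ (x ℤ.- y) ℤ.+ a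
  lemma = solve-∀

edgeProgression-term : ∀ ℓ s u e →
  ∃₂ λ a b → block ℓ s u a ℤ.- block ℓ s u b ≡ term (edgeProgression ℓ e) s u
edgeProgression-term ℓ s u e@(edge i k d _) with nonNegative (coordinate ℓ k ⊝ coordinate ℓ i)
... | true = k , i , block-gap ℓ s u e
... | false = i , k , (begin
  block ℓ s u i ℤ.- block ℓ s u k                             ≡⟨ j-i≡-[i-j] (block ℓ s u k) (block ℓ s u i) ⟩
  - (block ℓ s u k ℤ.- block ℓ s u i)                         ≡⟨ cong -_ (block-gap ℓ s u e) ⟩
  - (⟦ coordinate ℓ k ⊝ coordinate ℓ i ⟧ s ℤ.+ a)             ≡⟨ cong (λ x → - (x ℤ.+ a)) (⟦⊝⟧ (coordinate ℓ k) (coordinate ℓ i) s) ⟩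
  - (⟦ coordinate ℓ k ⟧ s ℤ.- ⟦ coordinate ℓ i ⟧ s ℤ.+ a)     ≡⟨ lemma (⟦ coordinate ℓ k ⟧ s) (⟦ coordinate ℓ i ⟧ s) a ⟩
  (⟦ coordinate ℓ i ⟧ s ℤ.- ⟦ coordinate ℓ k ⟧ s) ℤ.- a       ≡⟨ cong (ℤ._- a) (⟦⊝⟧ (coordinate ℓ i) (coordinate ℓ k) s) ⟨
  ⟦ coordinate ℓ i ⊝ coordinate ℓ k ⟧ s ℤ.- a                 ∎)
  where
  open ≡-Reasoning
  a = + (size d * u)
  lemma : ∀ x y a → - (x ℤ.- y ℤ.+ a) ≡ (y ℤ.- x) ℤ.- a
  lemma = solve-∀

hits-positive : ∀ {v s} p → 0 < hits v s p → ∃ λ u → u < eval (Progression.len p) s × v ≡ term p s u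
hits-positive {v} {s} p 0<hits with sum-positive 0<hits
... | _ , point∈ , 0<point with ∈-applyUpTo⁻ (λ u → point (v ℤ.- term p s u)) point∈
...   | u , u<n , refl = u , u<n , ℤ.i-j≡0⇒i≡j v (term p s u) (point-positive 0<point)

totalLength : List Line → Length
totalLength ℓs = sum (map (proj₁ ∘ Line.len) ℓs) , sum (map (proj₂ ∘ Line.len) ℓs)

length-lineBlocks : ∀ s ℓs → length (concatMap (lineBlocks s) ℓs) ≡ eval (totalLength ℓs) s
length-lineBlocks s [] = refl
length-lineBlocks s (line _ (n₁ , n₀) ∷ ℓs) = trans (length-++ (applyUpTo _ (n₁ * s + n₀)))
  (trans (cong₂ _+_ (length-applyUpTo _ (n₁ * s + n₀)) (length-lineBlocks s ℓs)) (lemma n₁ n₀ _ _ s))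
  where
  lemma : ∀ a b c d s → a * s + b + (c * s + d) ≡ (a + c) * s + (b + d)
  lemma = ℕSolver.solve-∀

interval : Length → Progression
interval (n₁ , n₀) = progression up (0ℤ , + 1) one (n₁ * 6 , n₀ * 6)

interval-hit : ∀ s n {d} → d < eval n s * 6 → 0 < totalHits (+ suc d) s (interval n ∷ [])
interval-hit s (n₁ , n₀) {d} d<n = ℕ.<-≤-trans (subst (λ k → 0 < point k) (sym at-d) (s≤s z≤n))
  (ℕ.≤-trans
    (∈⇒≤sum (∈-applyUpTo⁺ (λ u → point (+ suc d ℤ.- term (interval (n₁ , n₀)) s u))
      (subst (d <_) (lemma n₁ n₀ s) d<n)))
    (ℕ.m≤m+n _ 0))
  where
  lemma : ∀ a b s → (a * s + b) * 6 ≡ a * 6 * s + b * 6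
  lemma = ℕSolver.solve-∀
  at-d : + suc d ℤ.- (⟦ 0ℤ , + 1 ⟧ s ℤ.+ + (1 * d)) ≡ 0ℤ
  at-d rewrite ℕ.*-identityˡ d = ℤ.+-inverseʳ (+ suc d)

lineProgressions : List Line → List Progression
lineProgressions ℓs = cartesianProductWith edgeProgression ℓs edges

tiles? : ∀ ℓs → Maybe (Balanced (lineProgressions ℓs) (interval (totalLength ℓs) ∷ []))
tiles? ℓs = match _ _

linesPDF : ∀ ℓs → T (is-just (tiles? ℓs)) → ∀ s → PDF (eval (totalLength ℓs) s)
linesPDF ℓs tiles s = record
  { blocks = concatMap (lineBlocks s) ℓs
  ; #blocks = length-lineBlocks s ℓs
  ; surjective = surjective
  }
  where
  surjective : ∀ d → d < eval (totalLength ℓs) s * 6 →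
    ∃ λ p → p ∈ concatMap (lineBlocks s) ℓs × ∃₂ λ a b → p a ℤ.- p b ≡ + suc d
  some-hit : ∀ d → d < eval (totalLength ℓs) s * 6 → 0 < totalHits (+ suc d) s (lineProgressions ℓs)
  some-hit d d< = subst (0 <_)
    (sym (totalHits-≡ (+ suc d) s (lineProgressions ℓs) (interval (totalLength ℓs) ∷ [])
      (to-witness-T (tiles? ℓs) tiles)))
    (interval-hit s (totalLength ℓs) d<)
  surjective d d< with sum-positive (some-hit d d<)
  ... | _ , hits∈ , 0<hits with ∈-map⁻ (hits (+ suc d) s) hits∈
  ...   | _ , p∈ , refl with ∈-cartesianProductWith⁻ edgeProgression ℓs edges p∈
  ...     | ℓ , e , ℓ∈ , _ , refl with hits-positive (edgeProgression ℓ e) 0<hits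
  ...       | u , u<n , eq with edgeProgression-term ℓ s u e
  ...         | a , b , gap≡ = block ℓ s u , ∈-concatMap⁺ (lineBlocks s) (Any.map block∈ ℓ∈) , a , b , trans gap≡ (sym eq)
    where
    block∈ : ∀ {ℓ′} → ℓ ≡ ℓ′ → block ℓ s u ∈ lineBlocks s ℓ′
    block∈ refl = ∈-applyUpTo⁺ (block ℓ s) (subst (λ n → u < eval n s) (edgeProgression-len ℓ e) u<n)

PDM⟨_⟩ : ℕ → Set
PDM⟨ t ⟩ = HomogeneousPDM₃ (suc (t * 12))

column : ℕ → ℕ → ℕ → ℕ → Column
column a b c d = Vec.lookup (+ a ∷ + b ∷ + c ∷ + d ∷ [])

kleinPDM : ∀ blocks → let cols = orbits klein blocks in
  {_ : True (All.all? (λ i → All.all? (λ k → (toℕ i <? toℕ k) →-dec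
         All.all? (_∈? map (gap i k) cols) (centredRange (length cols))) (allFin 4)) (allFin 4))} →
  HomogeneousPDM₃ (length cols)
kleinPDM blocks {checked} = perfect⇒PDM (orbits klein blocks)
  (λ i k i<k → All.lookup (All.lookup (All.lookup (toWitness checked) (∈-allFin i)) (∈-allFin k) i<k))

pdm₂ : PDM⟨ 2 ⟩
pdm₂ = kleinPDM
  ( column 12 0 6 2 ∷ column 9 0 4 11 ∷ column 3 0 11 12
  ∷ column 9 3 0 10 ∷ column 2 0 5 10 ∷ column 12 4 11 0 ∷ [])

pdm₃ : PDM⟨ 3 ⟩
pdm₃ = kleinPDM
  ( column 16 11 0 18 ∷ column 17 6 9 0 ∷ column 15 0 4 10
  ∷ column 18 17 4 0 ∷ column 16 0 1 9 ∷ column 15 13 3 0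
  ∷ column 12 5 14 0 ∷ column 18 6 0 10 ∷ column 17 0 14 1 ∷ [])

segment : ℕ → (c₀ c₁ c₂ c₃ : ℕ × ℕ) → Line
segment n c₀ c₁ c₂ c₃ = line (c₀ ∷ c₁ ∷ c₂ ∷ c₃ ∷ []) (1 , n)

single : (c₁ c₂ c₃ : ℕ × ℕ) → Line
single c₁ c₂ c₃ = line ((0 , 0) ∷ c₁ ∷ c₂ ∷ c₃ ∷ []) (0 , 1)

constant : ℕ → ℕ → ℕ → Line
constant a b c = single (0 , a) (0 , b) (0 , c)

smallPDM : ∀ ℓs {_ : T (is-just (tiles? ℓs))} → PDM⟨ eval (totalLength ℓs) 0 ⟩
smallPDM ℓs {tiles} = PDF⇒PDM (linesPDF ℓs tiles 0)

pdm₁ : PDM⟨ 1 ⟩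
pdm₁ = smallPDM
  ( constant 1 4 6 ∷ [])

pdm₄ : PDM⟨ 4 ⟩
pdm₄ = smallPDM
  ( constant 4 13 24 ∷ constant 1 17 23 ∷ constant 3 8 18 ∷ constant 2 14 21 ∷ [])

pdm₅ : PDM⟨ 5 ⟩
pdm₅ = smallPDM
  ( constant 8 13 30 ∷ constant 6 20 29 ∷ constant 1 25 27 ∷ constant 3 15 19
  ∷ constant 7 18 28 ∷ [])

pdm₆ : PDM⟨ 6 ⟩
pdm₆ = smallPDM
  ( constant 1 17 36 ∷ constant 2 25 32 ∷ constant 4 9 31 ∷ constant 12 20 33
  ∷ constant 6 24 34 ∷ constant 3 14 29 ∷ [])

pdm₇ : PDM⟨ 7 ⟩
pdm₇ = smallPDM
  ( constant 7 27 42 ∷ constant 12 23 41 ∷ constant 3 16 40 ∷ constant 2 21 30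
  ∷ constant 4 26 36 ∷ constant 6 14 31 ∷ constant 1 34 39 ∷ [])

pdm₈ : PDM⟨ 8 ⟩
pdm₈ = smallPDM
  ( constant 10 19 48 ∷ constant 6 30 46 ∷ constant 12 34 47 ∷ constant 2 20 45
  ∷ constant 17 21 44 ∷ constant 8 15 41 ∷ constant 1 32 37 ∷ constant 3 14 42 ∷ [])

pdm₉ : PDM⟨ 9 ⟩
pdm₉ = smallPDM
  ( constant 1 11 54 ∷ constant 12 35 50 ∷ constant 16 18 52 ∷ constant 7 21 48
  ∷ constant 5 25 49 ∷ constant 8 30 47 ∷ constant 6 32 51 ∷ constant 3 31 40
  ∷ constant 4 33 46 ∷ [])

pdm₁₀ : PDM⟨ 10 ⟩
pdm₁₀ = smallPDM
  ( constant 8 35 60 ∷ constant 2 51 58 ∷ constant 16 28 57 ∷ constant 1 15 47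
  ∷ constant 5 38 44 ∷ constant 18 22 48 ∷ constant 17 36 59 ∷ constant 11 20 54
  ∷ constant 10 31 55 ∷ constant 3 40 53 ∷ [])

pdm₁₁ : PDM⟨ 11 ⟩
pdm₁₁ = smallPDM
  ( constant 14 44 66 ∷ constant 29 32 65 ∷ constant 17 41 64 ∷ constant 7 35 60
  ∷ constant 6 51 62 ∷ constant 19 34 61 ∷ constant 4 20 63 ∷ constant 1 50 55
  ∷ constant 12 21 58 ∷ constant 8 10 48 ∷ constant 18 31 57 ∷ [])

pdm₁₂ : PDM⟨ 12 ⟩
pdm₁₂ = smallPDM
  ( constant 17 41 72 ∷ constant 7 52 70 ∷ constant 23 37 71 ∷ constant 2 59 67
  ∷ constant 10 26 66 ∷ constant 11 15 61 ∷ constant 1 29 54 ∷ constant 6 44 64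
  ∷ constant 13 43 62 ∷ constant 22 27 69 ∷ constant 32 35 68 ∷ constant 9 21 60 ∷ [])

-- Found by computer.  At scale s the 36 differences of the six segments tile 36 cells of length s;
-- the single blocks fill the gaps that remain near the boundaries of the cells.
family₀ : List Line
family₀ =
  segment 1 (36 , 105) (7 , 19) (0 , 0) (18 , 55) ∷
  segment 0 (8 , 22) (0 , 0) (27 , 83) (23 , 74) ∷
  segment 1 (27 , 80) (0 , 0) (14 , 43) (9 , 29) ∷
  segment 1 (34 , 100) (0 , 0) (13 , 40) (34 , 104) ∷
  segment 1 (33 , 98) (0 , 0) (22 , 68) (30 , 93) ∷
  segment 1 (30 , 88) (0 , 0) (5 , 17) (30 , 94) ∷
  single (0 , 3) (15 , 49) (19 , 59) ∷ single (8 , 24) (23 , 72) (34 , 103) ∷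
  single (0 , 1) (25 , 76) (30 , 92) ∷ single (3 , 7) (25 , 74) (30 , 89) ∷
  single (7 , 22) (11 , 35) (29 , 87) ∷ single (4 , 11) (19 , 58) (32 , 96) ∷
  single (4 , 12) (7 , 20) (30 , 90) ∷ single (9 , 28) (23 , 69) (34 , 101) ∷
  single (0 , 2) (21 , 63) (32 , 97) ∷ single (6 , 18) (19 , 57) (34 , 102) ∷
  single (3 , 9) (14 , 42) (36 , 108) ∷ single (8 , 23) (15 , 44) (36 , 106) ∷
  single (9 , 26) (18 , 53) (36 , 107) ∷ []

family₁ : List Line
family₁ =
  segment 0 (36 , 77) (0 , 0) (5 , 12) (26 , 59) ∷
  segment 0 (33 , 71) (0 , 0) (17 , 38) (23 , 52) ∷
  segment 0 (29 , 61) (0 , 0) (16 , 36) (19 , 44) ∷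
  segment 0 (32 , 67) (0 , 0) (4 , 11) (29 , 66) ∷
  segment 0 (19 , 40) (0 , 0) (33 , 74) (19 , 45) ∷
  segment 0 (23 , 48) (0 , 0) (34 , 74) (23 , 51) ∷
  single (7 , 19) (14 , 33) (32 , 71) ∷ single (7 , 17) (10 , 20) (32 , 68) ∷
  single (7 , 18) (10 , 23) (35 , 76) ∷ single (3 , 4) (13 , 26) (32 , 69) ∷
  single (3 , 7) (14 , 32) (35 , 77) ∷ single (0 , 2) (21 , 46) (28 , 61) ∷
  single (6 , 12) (22 , 47) (35 , 74) ∷ single (0 , 1) (26 , 57) (33 , 73) ∷
  single (4 , 10) (18 , 40) (29 , 64) ∷ single (3 , 6) (26 , 55) (31 , 66) ∷
  single (13 , 28) (17 , 37) (36 , 78) ∷ single (4 , 8) (18 , 39) (35 , 75) ∷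
  single (10 , 21) (16 , 34) (29 , 63) ∷ []

family₂ : List Line
family₂ =
  segment 0 (36 , 83) (0 , 0) (5 , 13) (26 , 63) ∷
  segment 0 (33 , 76) (0 , 0) (17 , 42) (23 , 57) ∷
  segment 0 (29 , 66) (0 , 0) (16 , 39) (19 , 48) ∷
  segment 0 (32 , 73) (0 , 0) (4 , 11) (29 , 71) ∷
  segment 1 (19 , 44) (0 , 0) (33 , 79) (19 , 47) ∷
  segment 0 (23 , 52) (0 , 0) (34 , 80) (23 , 56) ∷
  single (3 , 7) (28 , 63) (35 , 83) ∷ single (3 , 4) (13 , 28) (32 , 74) ∷
  single (10 , 22) (17 , 41) (33 , 77) ∷ single (3 , 5) (10 , 21) (17 , 39) ∷
  single (0 , 2) (22 , 52) (26 , 62) ∷ single (4 , 9) (25 , 57) (35 , 80) ∷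
  single (7 , 15) (28 , 64) (35 , 81) ∷ single (11 , 27) (17 , 40) (33 , 78) ∷
  single (6 , 14) (19 , 45) (35 , 82) ∷ single (3 , 6) (29 , 67) (32 , 75) ∷
  single (0 , 1) (13 , 30) (31 , 73) ∷ single (5 , 11) (23 , 53) (28 , 65) ∷
  single (11 , 25) (25 , 58) (36 , 84) ∷ []

family₃ : List Line
family₃ =
  segment 1 (36 , 90) (0 , 0) (5 , 13) (26 , 68) ∷
  segment 0 (33 , 83) (0 , 0) (17 , 46) (23 , 63) ∷
  segment 0 (29 , 73) (0 , 0) (16 , 42) (19 , 52) ∷
  segment 1 (32 , 80) (0 , 0) (4 , 11) (29 , 76) ∷
  segment 0 (19 , 46) (0 , 0) (33 , 86) (19 , 51) ∷
  segment 0 (23 , 56) (0 , 0) (34 , 88) (23 , 62) ∷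
  single (0 , 1) (14 , 38) (17 , 43) ∷ single (0 , 2) (11 , 31) (32 , 83) ∷
  single (11 , 30) (21 , 53) (34 , 87) ∷ single (0 , 3) (21 , 54) (28 , 73) ∷
  single (10 , 24) (17 , 45) (33 , 85) ∷ single (3 , 8) (17 , 44) (28 , 71) ∷
  single (5 , 12) (23 , 58) (34 , 86) ∷ single (3 , 7) (31 , 79) (35 , 89) ∷
  single (6 , 14) (25 , 62) (31 , 78) ∷ single (7 , 20) (10 , 26) (23 , 59) ∷
  single (7 , 17) (26 , 66) (33 , 84) ∷ single (6 , 15) (19 , 50) (29 , 75) ∷
  single (13 , 32) (16 , 41) (35 , 88) ∷ []

family₄ : List Line
family₄ =
  segment 1 (36 , 95) (0 , 0) (5 , 14) (26 , 72) ∷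
  segment 0 (33 , 86) (0 , 0) (17 , 47) (23 , 64) ∷
  segment 0 (29 , 75) (0 , 0) (16 , 44) (19 , 54) ∷
  segment 1 (32 , 84) (0 , 0) (4 , 13) (29 , 80) ∷
  segment 0 (19 , 50) (0 , 0) (33 , 90) (19 , 55) ∷
  segment 1 (23 , 60) (0 , 0) (34 , 92) (23 , 63) ∷
  single (7 , 22) (10 , 28) (23 , 62) ∷ single (7 , 21) (10 , 26) (32 , 85) ∷
  single (6 , 16) (16 , 41) (35 , 94) ∷ single (7 , 17) (26 , 69) (36 , 96) ∷
  single (0 , 2) (26 , 70) (33 , 89) ∷ single (4 , 10) (23 , 61) (29 , 76) ∷
  single (4 , 11) (17 , 46) (33 , 88) ∷ single (0 , 1) (18 , 48) (34 , 91) ∷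
  single (3 , 8) (28 , 73) (31 , 82) ∷ single (13 , 33) (17 , 45) (31 , 83) ∷
  single (7 , 20) (17 , 44) (28 , 75) ∷ single (14 , 36) (21 , 54) (35 , 93) ∷
  single (11 , 30) (14 , 37) (32 , 86) ∷ []

family₅ : List Line
family₅ =
  segment 1 (36 , 102) (0 , 0) (5 , 16) (26 , 78) ∷
  segment 1 (33 , 94) (0 , 0) (17 , 50) (23 , 69) ∷
  segment 0 (29 , 82) (0 , 0) (16 , 48) (19 , 59) ∷
  segment 1 (32 , 90) (0 , 0) (4 , 13) (29 , 87) ∷
  segment 1 (19 , 54) (0 , 0) (33 , 97) (19 , 58) ∷
  segment 0 (23 , 65) (0 , 0) (34 , 100) (23 , 70) ∷
  single (7 , 22) (10 , 27) (32 , 92) ∷ single (4 , 11) (11 , 34) (21 , 60) ∷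
  single (3 , 6) (13 , 35) (32 , 91) ∷ single (3 , 10) (19 , 57) (32 , 93) ∷
  single (3 , 9) (14 , 42) (25 , 73) ∷ single (0 , 2) (23 , 68) (28 , 82) ∷
  single (0 , 1) (26 , 76) (33 , 96) ∷ single (7 , 21) (25 , 72) (35 , 100) ∷
  single (3 , 7) (17 , 48) (31 , 88) ∷ single (13 , 37) (16 , 45) (34 , 98) ∷
  single (6 , 18) (10 , 30) (31 , 89) ∷ single (5 , 15) (23 , 67) (34 , 99) ∷
  single (13 , 38) (19 , 55) (35 , 101) ∷ []

familyPDM : ∀ r k ℓs {_ : T (is-just (tiles? ℓs))} q → totalLength ℓs ≡ (6 , r + k * 6) →
            PDM⟨ r + (k + q) * 6 ⟩
familyPDM r k ℓs {tiles} q len≡ =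
  subst PDM⟨_⟩ (trans (cong (λ n → eval n q) len≡) (rearrange r k q)) (PDF⇒PDM (linesPDF ℓs tiles q))
  where
  rearrange : ∀ r k q → 6 * q + (r + k * 6) ≡ r + (k + q) * 6
  rearrange = ℕSolver.solve-∀

pdmByResidue : ∀ q r → r < 6 → PDM⟨ r + q * 6 ⟩
pdmByResidue 0 0 _ = smallPDM []
pdmByResidue 1 0 _ = pdm₆
pdmByResidue 2 0 _ = pdm₁₂
pdmByResidue (suc (suc (suc q))) 0 _ = familyPDM 0 3 family₀ q refl
pdmByResidue 0 1 _ = pdm₁
pdmByResidue 1 1 _ = pdm₇
pdmByResidue (suc (suc q)) 1 _ = familyPDM 1 2 family₁ q refl
pdmByResidue 0 2 _ = pdm₂
pdmByResidue 1 2 _ = pdm₈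
pdmByResidue (suc (suc q)) 2 _ = familyPDM 2 2 family₂ q refl
pdmByResidue 0 3 _ = pdm₃
pdmByResidue 1 3 _ = pdm₉
pdmByResidue (suc (suc q)) 3 _ = familyPDM 3 2 family₃ q refl
pdmByResidue 0 4 _ = pdm₄
pdmByResidue 1 4 _ = pdm₁₀
pdmByResidue (suc (suc q)) 4 _ = familyPDM 4 2 family₄ q refl
pdmByResidue 0 5 _ = pdm₅
pdmByResidue 1 5 _ = pdm₁₁
pdmByResidue (suc (suc q)) 5 _ = familyPDM 5 2 family₅ q refl
pdmByResidue _ (suc (suc (suc (suc (suc (suc _)))))) (s≤s (s≤s (s≤s (s≤s (s≤s (s≤s ()))))))

theorem6p7 : ∀ (n : ℕ) → n % 12 ≡ 1 →
    Σ (Matrix 3 n) (λ D → IsPDM D × IsHomogeneous D)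
theorem6p7 n n%12≡1 = subst HomogeneousPDM₃ (sym n≡)
  (subst PDM⟨_⟩ (sym t≡) (pdmByResidue (t / 6) (t % 6) (m%n<n t 6)))
  where
  t = n / 12
  n≡ : n ≡ suc (t * 12)
  n≡ = trans (m≡m%n+[m/n]*n n 12) (cong (_+ t * 12) n%12≡1)
  t≡ : t ≡ t % 6 + t / 6 * 6
  t≡ = m≡m%n+[m/n]*n t 6
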